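{- Let $G=(V,E)$ be a graph and let $k\ge 1$ be an integer. Then $G$ is a $k$-median graph if and only if there are $k$ (distinct) vertices $\mu_1,\dots,\mu_k\in V$ such that, for each $1\le i\le k$, the vertex $\mu_i$ is a median-consistent vertex in every $\mu_i$-convex subgraph of $G$.
   Context: All graphs are finite, simple and undirected; $d_G$ is the shortest-path distance. For $x,y\in V(G)$, the interval $I_G(x,y)$ is the set of all vertices lying on shortest $(x,y)$-paths in $G$ (it is empty if $x,y$ lie in different connected components), and $I_G(x,y,z):=I_G(x,y)\cap I_G(x,z)\cap I_G(y,z)$. A vertex $\mu\in V(G)$ is median-consistent in $G$ if $|I_G(\mu,x,y)|=1$ for all $x,y\in V(G)$. A graph is a $k$-median graph ($k\geq 1$) if it has (at least) $k$ median-consistent vertices. Subgraphs need not be induced. For $v\in V(G)$, a subgraph $H$ of $G$ is $v$-convex if $v\in V(H)$ and, for all $x\in V(H)$, every shortest path in $G$ connecting $v$ and $x$ is contained in $H$ (all its vertices and edges). -}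

module Defs where

open import Level using (0ℓ)
open import Data.Nat.Base using (ℕ; zero; suc; _≤_)
open import Data.Fin.Base using (Fin)
open import Data.Fin.Subset using (Subset; _∈_; _⊆_; ∣_∣)
open import Data.List.Base using (List; []; _∷_)
open import Data.List.Membership.Propositional using () renaming (_∈_ to _∈ₗ_)
open import Data.List.Relation.Unary.Unique.Propositional using (Unique)
open import Data.Product.Base using (∃; ∃-syntax; _×_)
open import Function.Bundles using (_⇔_)
open import Relation.Binary.Core using (Rel)
open import Relation.Binary.Definitions using (Symmetric; Irreflexive; Decidable)
open import Relation.Binary.PropositionalEquality.Core using (_≡_)
open import Relation.Unary using (Pred; _∩_)

private
  variable
    n : ℕ

-- Vertices are drawn from the ambient finite set Fin n, but the vertex set V
-- may be any subset of it.  Hence a graph and its subgraphs, which may have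
-- fewer vertices as well as fewer edges, are objects of the same type.

record Graph (n : ℕ) : Set₁ where
  field
    V      : Subset n
    E      : Rel (Fin n) 0ℓ
    E?     : Decidable E
    E⇒∈V   : ∀ {x y} → E x y → x ∈ V
    sym    : Symmetric E
    irrefl : Irreflexive _≡_ E

open Graph public using (V; E)

record Subgraph (H G : Graph n) : Set where
  field
    V⊆ : V H ⊆ V G
    E⊆ : ∀ {x y} → E H x y → E G x y

data Walk (G : Graph n) : Fin n → Fin n → Set where
  stop : ∀ {x} → x ∈ V G → Walk G x x
  step : ∀ {x y z} → E G x y → Walk G y z → Walk G x z

module _ {G : Graph n} where

  vertices : ∀ {x y} → Walk G x y → List (Fin n)
  vertices (stop {x} _)   = x ∷ []
  vertices (step {x} _ w) = x ∷ vertices w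

  length : ∀ {x y} → Walk G x y → ℕ
  length (stop _)   = zero
  length (step _ w) = suc (length w)

  IsPath : ∀ {x y} → Walk G x y → Set
  IsPath w = Unique (vertices w)

  IsShortestPath : ∀ {x y} → Walk G x y → Set
  IsShortestPath {x} {y} w =
    IsPath w × (∀ (w′ : Walk G x y) → IsPath w′ → length w ≤ length w′)

  infix 4 _ContainedIn_

  _ContainedIn_ : ∀ {x y} → Walk G x y → Graph n → Set
  stop {x} _         ContainedIn H = x ∈ V H
  step {x} {y} _ w   ContainedIn H = x ∈ V H × E H x y × w ContainedIn H

Interval : Graph n → Fin n → Fin n → Pred (Fin n) 0ℓ
Interval G x y v = ∃[ w ] IsShortestPath {G = G} {x} {y} w × v ∈ₗ vertices w

Interval₃ : Graph n → Fin n → Fin n → Fin n → Pred (Fin n) 0ℓ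
Interval₃ G x y z = Interval G x y ∩ Interval G x z ∩ Interval G y z

HasCardinality : Pred (Fin n) 0ℓ → ℕ → Set
HasCardinality {n} P k =
  ∃ λ (S : Subset n) → (∀ v → v ∈ S ⇔ P v) × ∣ S ∣ ≡ k

MedianConsistent : Graph n → Pred (Fin n) 0ℓ
MedianConsistent G μ =
  μ ∈ V G ×
  (∀ {x y} → x ∈ V G → y ∈ V G → HasCardinality (Interval₃ G μ x y) 1)

-- "At least k" : some set of median-consistent vertices has size ≥ k.

IsMedianGraph : ℕ → Graph n → Set
IsMedianGraph {n} k G =
  ∃ λ (S : Subset n) → (∀ {μ} → μ ∈ S → MedianConsistent G μ) × k ≤ ∣ S ∣

record ConvexSubgraph (v : Fin n) (H G : Graph n) : Set where
  field
    subgraph : Subgraph H G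
    v∈V      : v ∈ V H
    convex   : ∀ {x} → x ∈ V H →
               (w : Walk G v x) → IsShortestPath w → w ContainedIn H

{-# OPTIONS --safe #-}

-- Let μ be median-consistent in G, let H be a μ-convex subgraph, and let m be
-- the median in G of μ, x and y, where x, y ∈ V H.  Shortest (μ,x)- and
-- (μ,y)-paths of G through m lie in H; glued at m, their final parts form a
-- shortest (x,y)-path of G that lies in H.  So H has the same distances as G
-- between μ, x and y, whence m ∈ I_H(μ,x,y) ⊆ I_G(μ,x,y) = {m}.
-- Conversely, G is a μ-convex subgraph of itself.

module Submission where

open import Defs
open import Data.Nat.Base using (ℕ; zero; suc; _+_; _≤_; z≤n; s≤s; s≤s⁻¹)
open import Data.Nat.Properties
  using (≤-refl; ≤-trans; ≤-reflexive; m≤n⇒m≤1+n; m≤n+m; +-comm; +-mono-≤;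
         +-cancelˡ-≤; 1+n≰n; <-irrefl; module ≤-Reasoning)
open import Data.Fin.Base using (Fin; zero; suc; inject≤)
open import Data.Fin.Properties using (_≟_; suc-injective; inject≤-injective)
open import Data.Fin.Subset
  using (Subset; inside; outside; _∈_; ∣_∣; ⁅_⁆; _∪_; ⊥)
open import Data.Fin.Subset.Properties
  using (x∈⁅x⁆; x∈⁅y⁆⇒x≡y; ∣⁅x⁆∣≡1; p⊂q⇒∣p∣<∣q∣; x∈p∪q⁻; p⊆p∪q; q⊆p∪q; ∉⊥)
open import Data.List.Membership.Propositional using () renaming (_∈_ to _∈ₗ_)
import Data.List.Membership.DecPropositional as DecMembership
open import Data.List.Relation.Unary.All using ([])
open import Data.List.Relation.Unary.All.Properties.Core using (¬Any⇒All¬)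
open import Data.List.Relation.Unary.AllPairs using ([]; _∷_)
open import Data.List.Relation.Unary.Any using (here; there)
open import Data.Product.Base using (∃; ∃₂; _×_; _,_; proj₁)
open import Data.Sum.Base using (inj₁; inj₂)
open import Data.Vec.Base using (_∷_; here; there)
open import Function.Base using (_∘_; id)
open import Function.Bundles using (_⇔_; mk⇔; module Equivalence)
open import Function.Definitions using (Injective)
open import Relation.Binary.PropositionalEquality
  using (_≡_; refl; sym; trans; cong; cong₂; subst; module ≡-Reasoning)
open import Relation.Nullary using (¬_; yes; no; contradiction)
open import Relation.Unary using (Pred)
open import Level using (0ℓ)

private
  variable
    n : ℕ
    G H : Graph n
    x y z v μ : Fin n

-- Subsets and their cardinalities

-- Lists the members of `S` in increasing order, so that a set of at least `k` vertices yields an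
-- injective family indexed by `Fin k`. The passage back is `image`.
element : (S : Subset n) → Fin ∣ S ∣ → Fin n
element (inside  ∷ S) zero    = zero
element (inside  ∷ S) (suc i) = suc (element S i)
element (outside ∷ S) i       = suc (element S i)

element-∈ : (S : Subset n) (i : Fin ∣ S ∣) → element S i ∈ S
element-∈ (inside  ∷ S) zero    = here
element-∈ (inside  ∷ S) (suc i) = there (element-∈ S i)
element-∈ (outside ∷ S) i       = there (element-∈ S i)

element-injective : (S : Subset n) → Injective _≡_ _≡_ (element S)
element-injective (inside  ∷ S) {zero}  {zero}  eq = refl
element-injective (inside  ∷ S) {suc i} {suc j} eq =
  cong suc (element-injective S (suc-injective eq))
element-injective (outside ∷ S) eq = element-injective S (suc-injective eq)

image : ∀ {k} → (Fin k → Fin n) → Subset n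
image {k = zero}  f = ⊥
image {k = suc k} f = ⁅ f zero ⁆ ∪ image (f ∘ suc)

∈-image⁻ : ∀ {k} (f : Fin k → Fin n) → v ∈ image f → ∃ λ i → f i ≡ v
∈-image⁻ {k = zero}  f v∈ = contradiction v∈ ∉⊥
∈-image⁻ {k = suc k} f v∈ with x∈p∪q⁻ ⁅ f zero ⁆ (image (f ∘ suc)) v∈
... | inj₁ v∈⁅f0⁆ = zero , sym (x∈⁅y⁆⇒x≡y _ v∈⁅f0⁆)
... | inj₂ v∈tail with ∈-image⁻ (f ∘ suc) v∈tail
...   | i , fi≡v = suc i , fi≡v

-- Induction on `k`: by injectivity `f zero` is not a value of `f ∘ suc`, so adding it enlarges the
-- image strictly.
injective⇒≤∣image∣ : ∀ {k} (f : Fin k → Fin n) → Injective _≡_ _≡_ f →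
                     k ≤ ∣ image f ∣
injective⇒≤∣image∣ {k = zero}  f inj = z≤n
injective⇒≤∣image∣ {k = suc k} f inj =
  ≤-trans (s≤s (injective⇒≤∣image∣ (f ∘ suc) (suc-injective ∘ inj)))
          (p⊂q⇒∣p∣<∣q∣
            ( q⊆p∪q ⁅ f zero ⁆ (image (f ∘ suc))
            , f zero
            , p⊆p∪q _ (x∈⁅x⁆ _)
            , λ f0∈ → f0∉ (∈-image⁻ (f ∘ suc) f0∈)))
  where
  f0∉ : ¬ (∃ λ i → f (suc i) ≡ f zero)
  f0∉ (i , eq) with () ← inj eq

-- A second member `u` of `S` would make `⁅ m ⁆` a proper subset of `S`, although both have size 1.
cardinality-1⁻ : {P : Pred (Fin n) 0ℓ} → HasCardinality P 1 →
                 ∃ λ m → P m × (∀ {u} → P u → u ≡ m)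
cardinality-1⁻ {P = P} (S , S⇔P , ∣S∣≡1) =
  m , Equivalence.to (S⇔P m) m∈S , λ {u} → unique u ∘ Equivalence.from (S⇔P u)
  where
  first : Fin ∣ S ∣
  first = subst Fin (sym ∣S∣≡1) zero
  m = element S first
  m∈S = element-∈ S first
  unique : ∀ u → u ∈ S → u ≡ m
  unique u u∈S with u ≟ m
  ... | yes u≡m = u≡m
  ... | no  u≢m = contradiction
    (p⊂q⇒∣p∣<∣q∣ {p = ⁅ m ⁆} {q = S}
      ( (λ v∈ → subst (_∈ S) (sym (x∈⁅y⁆⇒x≡y m v∈)) m∈S)
      , u , u∈S , u≢m ∘ x∈⁅y⁆⇒x≡y m))
    (<-irrefl (trans (∣⁅x⁆∣≡1 m) (sym ∣S∣≡1)))

cardinality-1⁺ : {P : Pred (Fin n) 0ℓ} (m : Fin n) → P m →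
                 (∀ {u} → P u → u ≡ m) → HasCardinality P 1
cardinality-1⁺ {P = P} m Pm unique =
  ⁅ m ⁆
  , (λ v → mk⇔ (λ v∈ → subst P (sym (x∈⁅y⁆⇒x≡y m v∈)) Pm)
               (λ Pv → subst (_∈ ⁅ m ⁆) (sym (unique Pv)) (x∈⁅x⁆ m)))
  , ∣⁅x⁆∣≡1 m

-- Walks

start∈V : Walk G x y → x ∈ V G
start∈V         (stop x∈V) = x∈V
start∈V {G = G} (step e _) = Graph.E⇒∈V G e

infixr 5 _++_

_++_ : Walk G x y → Walk G y z → Walk G x z
stop _   ++ w′ = w′
step e w ++ w′ = step e (w ++ w′)

length-++ : (w : Walk G x y) (w′ : Walk G y z) →
            length (w ++ w′) ≡ length w + length w′
length-++ (stop _)   w′ = refl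
length-++ (step e w) w′ = cong suc (length-++ w w′)

start∈vertices : (w : Walk G x y) → x ∈ₗ vertices w
start∈vertices (stop _)   = here refl
start∈vertices (step _ _) = here refl

joint∈vertices : (w : Walk G x y) (w′ : Walk G y z) → y ∈ₗ vertices (w ++ w′)
joint∈vertices (stop _)   w′ = start∈vertices w′
joint∈vertices (step e w) w′ = there (joint∈vertices w w′)

reverse : Walk G x y → Walk G y x
reverse         (stop x∈V) = stop x∈V
reverse {G = G} (step e w) =
  reverse w ++ step (Graph.sym G e) (stop (Graph.E⇒∈V G e))

length-reverse : (w : Walk G x y) → length (reverse w) ≡ length w
length-reverse         (stop _)   = refl
length-reverse {G = G} (step e w) = begin
  length (reverse w ++ last)  ≡⟨ length-++ (reverse w) last ⟩
  length (reverse w) + 1      ≡⟨ cong (_+ 1) (length-reverse w) ⟩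
  length w + 1                ≡⟨ +-comm (length w) 1 ⟩
  suc (length w)              ∎
  where
  open ≡-Reasoning
  last = step {G = G} (Graph.sym G e) (stop (Graph.E⇒∈V G e))

splitAt : (w : Walk G x y) → v ∈ₗ vertices w →
          ∃₂ λ (a : Walk G x v) (b : Walk G v y) → length a + length b ≡ length w
splitAt (stop x∈V) (here refl) = stop x∈V , stop x∈V , refl
splitAt (step e w) (here refl) = stop (start∈V (step e w)) , step e w , refl
splitAt (step e w) (there v∈w) with splitAt w v∈w
... | a , b , eq = step e a , b , cong suc eq

path-suffix : (w : Walk G x y) → IsPath w → v ∈ₗ vertices w →
              ∃ λ (w′ : Walk G v y) → IsPath w′ × length w′ ≤ length w
path-suffix w@(stop _)   w-path       (here refl) = w , w-path , ≤-refl
path-suffix w@(step _ _) w-path       (here refl) = w , w-path , ≤-refl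
path-suffix (step e w)   (_ ∷ w-path) (there v∈w) with path-suffix w w-path v∈w
... | w′ , w′-path , w′≤w = w′ , w′-path , m≤n⇒m≤1+n w′≤w

-- Shorten the tail to a path first. If `x` recurs on that path, its part from `x` onwards is
-- already a path from `x`, and the closed detour before it is dropped.
walk⇒path : (w : Walk G x y) →
            ∃ λ (w′ : Walk G x y) → IsPath w′ × length w′ ≤ length w
walk⇒path (stop x∈V) = stop x∈V , [] ∷ [] , z≤n
walk⇒path (step {x} e w) with walk⇒path w
... | w′ , w′-path , w′≤w with DecMembership._∈?_ _≟_ x (vertices w′)
...   | no  x∉w′ = step e w′ , ¬Any⇒All¬ _ x∉w′ ∷ w′-path , s≤s w′≤w
...   | yes x∈w′ with path-suffix w′ w′-path x∈w′
...     | w″ , w″-path , w″≤w′ =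
  w″ , w″-path , m≤n⇒m≤1+n (≤-trans w″≤w′ w′≤w)

-- Minimality is tested against all walks, whereas `IsShortestPath` compares with paths only. Walks
-- can be glued and reversed without checking for repeated vertices; the lemmas below show that both
-- notions agree.
Geodesic : Walk G x y → Set
Geodesic {G = G} {x} {y} w = ∀ (w′ : Walk G x y) → length w ≤ length w′

geodesic⇒path : (w : Walk G x y) → Geodesic w → IsPath w
geodesic⇒path (stop _)       geo = [] ∷ []
geodesic⇒path (step {x} e w) geo =
  -- The tail is geodesic too, since `e` can be put in front of any rival `w′`.
  ¬Any⇒All¬ _ x∉w ∷ geodesic⇒path w (λ w′ → s≤s⁻¹ (geo (step e w′)))
  where
  x∉w : ¬ (x ∈ₗ vertices w)
  x∉w x∈w with splitAt w x∈w
  -- If `x` recurs on `w`, the remainder `b` is a rival of `step e w` that is shorter by at least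
  -- the edge `e`.
  ... | a , b , eq = 1+n≰n (≤-trans (geo b)
    (≤-trans (m≤n+m _ (length a)) (≤-reflexive eq)))

geodesic⇒shortest : (w : Walk G x y) → Geodesic w → IsShortestPath w
geodesic⇒shortest w geo = geodesic⇒path w geo , λ w′ _ → geo w′

shortest⇒geodesic : (w : Walk G x y) → IsShortestPath w → Geodesic w
shortest⇒geodesic w (_ , shortest) w′ with walk⇒path w′
... | w″ , w″-path , w″≤w′ = ≤-trans (shortest w″ w″-path) w″≤w′

-- Intervals

-- The metric form of the interval, d(x,v) + d(v,y) = d(x,y), with walks as witnesses in place of a
-- distance function.
Between : Graph n → Fin n → Fin n → Fin n → Set
Between G x y v = ∃₂ λ (a : Walk G x v) (b : Walk G v y) →
                  ∀ (w : Walk G x y) → length a + length b ≤ length w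

interval⇒between : Interval G x y v → Between G x y v
interval⇒between (w , w-shortest , v∈w) with splitAt w v∈w
... | a , b , eq =
  a , b , λ w′ → ≤-trans (≤-reflexive eq) (shortest⇒geodesic w w-shortest w′)

++-geodesic : (a : Walk G x y) (b : Walk G y z) →
              (∀ (w : Walk G x z) → length a + length b ≤ length w) →
              Geodesic (a ++ b)
++-geodesic a b a+b≤ w = ≤-trans (≤-reflexive (length-++ a b)) (a+b≤ w)

between⇒interval : Between G x y v → Interval G x y v
between⇒interval (a , b , a+b≤) =
  a ++ b , geodesic⇒shortest (a ++ b) (++-geodesic a b a+b≤) , joint∈vertices a b

-- Subgraphs

module _ {H G : Graph n} (H⊆G : Subgraph H G) where
  open Subgraph H⊆G

  embed : Walk H x y → Walk G x y
  embed (stop x∈V) = stop (V⊆ x∈V)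
  embed (step e w) = step (E⊆ e) (embed w)

  length-embed : (w : Walk H x y) → length (embed w) ≡ length w
  length-embed (stop _)   = refl
  length-embed (step e w) = cong suc (length-embed w)

  lower-bound-in-subgraph : ∀ {l} → (∀ (w : Walk G x y) → l ≤ length w) →
                            ∀ (w : Walk H x y) → l ≤ length w
  lower-bound-in-subgraph l≤ w = ≤-trans (l≤ (embed w)) (≤-reflexive (length-embed w))

  -- The walk `w` certifies that `H` preserves the distance from `x` to `y` in `G`; hence walks that
  -- are shortest in `H` stay shortest in `G`.
  between-embed : (w : Walk H x y) → (∀ (w′ : Walk G x y) → length w ≤ length w′) →
                  Between H x y v → Between G x y v
  between-embed w w≤ (a , b , a+b≤) = embed a , embed b , λ w′ → begin
    length (embed a) + length (embed b) ≡⟨ cong₂ _+_ (length-embed a) (length-embed b) ⟩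
    length a + length b                 ≤⟨ a+b≤ w ⟩
    length w                            ≤⟨ w≤ w′ ⟩
    length w′                           ∎
    where open ≤-Reasoning

restrict : (w : Walk G x y) → w ContainedIn H → Walk H x y
restrict (stop _)   x∈V           = stop x∈V
restrict (step _ w) (_ , e , w⊆H) = step e (restrict w w⊆H)

length-restrict : (w : Walk G x y) (w⊆H : w ContainedIn H) →
                  length (restrict {H = H} w w⊆H) ≡ length w
length-restrict (stop _)   _             = refl
length-restrict (step _ w) (_ , _ , w⊆H) = cong suc (length-restrict w w⊆H)

contained-start : (w : Walk G x y) → w ContainedIn H → x ∈ V H
contained-start (stop _)   x∈V       = x∈V
contained-start (step _ _) (x∈V , _) = x∈V

contained-++⁻ : (a : Walk G x y) (b : Walk G y z) → (a ++ b) ContainedIn H →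
                a ContainedIn H × b ContainedIn H
contained-++⁻ (stop _)   b b⊆H = contained-start b b⊆H , b⊆H
contained-++⁻ (step _ a) b (x∈V , e , ab⊆H) with contained-++⁻ a b ab⊆H
... | a⊆H , b⊆H = (x∈V , e , a⊆H) , b⊆H

contained-self : (w : Walk G x y) → w ContainedIn G
contained-self         (stop x∈V) = x∈V
contained-self {G = G} (step e w) = Graph.E⇒∈V G e , e , contained-self w

convex-self : μ ∈ V G → ConvexSubgraph μ G G
convex-self μ∈V = record
  { subgraph = record { V⊆ = id ; E⊆ = id }
  ; v∈V      = μ∈V
  ; convex   = λ _ w _ → contained-self w
  }

-- Heredity of median-consistency in convex subgraphs

medianConsistent-convex : MedianConsistent G μ → ConvexSubgraph μ H G →
                          MedianConsistent H μ
medianConsistent-convex {n} {G} {μ} {H} (_ , median) H-convex = v∈V , median-H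
  where
  open ConvexSubgraph H-convex
  open Subgraph subgraph

  -- Convexity applies to the geodesic `a ++ b`, hence to both of its halves. The bound still ranges
  -- over walks of `G`, so the restricted walks realise distances of `G`.
  restrict-between : x ∈ V H → Between G μ x v →
    ∃₂ λ (a : Walk H μ v) (b : Walk H v x) →
    ∀ (w : Walk G μ x) → length a + length b ≤ length w
  restrict-between {v = v} x∈V (a , b , a+b≤)
    with contained-++⁻ a b
           (convex x∈V (a ++ b) (geodesic⇒shortest (a ++ b) (++-geodesic a b a+b≤)))
  ... | a⊆H , b⊆H = restrict a a⊆H , restrict b b⊆H ,
    λ w → ≤-trans (≤-reflexive (cong₂ _+_ (length-restrict a a⊆H) (length-restrict b b⊆H)))
                  (a+b≤ w)

  -- Following `a` by `c` gives a walk of `G` from `μ` to `x`; cancelling `length a` leaves the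
  -- claim. So `b` realises the distance in `G` between its ends.
  shorter-tail : (a : Walk H μ v) (b : Walk H v x) →
                 (∀ (w : Walk G μ x) → length a + length b ≤ length w) →
                 (c : Walk G v x) → length b ≤ length c
  shorter-tail a b a+b≤ c = +-cancelˡ-≤ (length a) _ _ (begin
    length a + length b     ≤⟨ a+b≤ (a′ ++ c) ⟩
    length (a′ ++ c)        ≡⟨ length-++ a′ c ⟩
    length a′ + length c    ≡⟨ cong (_+ length c) (length-embed subgraph a) ⟩
    length a + length c     ∎)
    where
    open ≤-Reasoning
    a′ = embed subgraph a

  median-H : x ∈ V H → y ∈ V H → HasCardinality (Interval₃ H μ x y) 1
  median-H {x} {y} x∈V y∈V
    with m , (μmx , μmy , xmy) , unique ← cardinality-1⁻ (median (V⊆ x∈V) (V⊆ y∈V))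
    with a , b , a+b≤ ← restrict-between x∈V (interval⇒between μmx)
    with c , d , c+d≤ ← restrict-between y∈V (interval⇒between μmy)
    -- These two walks may leave `H`; only their lengths are used, to bound those of `b` and `d`.
    with p , q , p+q≤ ← interval⇒between xmy
    = cardinality-1⁺ m
        ( inH a b a+b≤ , inH c d c+d≤ , inH (reverse b) d b+d≤ )
        -- Each of the three distances is the same in `H` as in `G`, so a median `u` in `H` is one
        -- in `G` and must be `m`.
        (λ (μux , μuy , xuy) →
          unique (inG a b a+b≤ μux , inG c d c+d≤ μuy , inG (reverse b) d b+d≤ xuy))
    where
    inH : ∀ {s t m} (a : Walk H s m) (b : Walk H m t) →
          (∀ (w : Walk G s t) → length a + length b ≤ length w) → Interval H s t m
    inH a b a+b≤ = between⇒interval (a , b , lower-bound-in-subgraph subgraph a+b≤)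

    -- The walk `a ++ b` lies in `H` and is geodesic in `G`, which is the certificate that
    -- `between-embed` asks for.
    inG : ∀ {s t m u} (a : Walk H s m) (b : Walk H m t) →
          (∀ (w : Walk G s t) → length a + length b ≤ length w) →
          Interval H s t u → Interval G s t u
    inG a b a+b≤ =
      between⇒interval ∘ between-embed subgraph (a ++ b)
        (λ w → ≤-trans (≤-reflexive (length-++ a b)) (a+b≤ w)) ∘ interval⇒between

    -- Both `b` and `d` are shortest in `G`, so gluing them at `m` costs no more than the shortest
    -- route through `m` formed by `p` and `q`.
    b+d≤ : ∀ (w : Walk G x y) → length (reverse b) + length d ≤ length w
    b+d≤ w = begin
      length (reverse b) + length d ≡⟨ cong (_+ length d) (length-reverse b) ⟩
      length b + length d           ≤⟨ +-mono-≤ (shorter-tail a b a+b≤ (reverse p))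
                                                (shorter-tail c d c+d≤ q) ⟩
      length (reverse p) + length q ≡⟨ cong (_+ length q) (length-reverse p) ⟩
      length p + length q           ≤⟨ p+q≤ w ⟩
      length w                      ∎
      where open ≤-Reasoning

mainTheorem1 : ∀ {n : ℕ} (G : Graph n) (k : ℕ) → 1 ≤ k →
    IsMedianGraph k G ⇔
    (∃ λ (μ : Fin k → Fin n) →
    Injective _≡_ _≡_ μ ×
    (∀ i → μ i ∈ V G) ×
    (∀ i (H : Graph n) → ConvexSubgraph (μ i) H G → MedianConsistent H (μ i)))
mainTheorem1 G k _ = mk⇔
  (λ (S , consistent , k≤∣S∣) →
    -- `inject≤` picks the first `k` members of `S`.
    let μ  = λ i → element S (inject≤ i k≤∣S∣)
        mc = λ i → consistent (element-∈ S (inject≤ i k≤∣S∣))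
    in μ
     , (λ eq → inject≤-injective k≤∣S∣ k≤∣S∣ _ _ (element-injective S eq))
     , (λ i → proj₁ (mc i))
     , (λ i H → medianConsistent-convex (mc i)))
  (λ (μ , μ-injective , μ∈V , consistent) →
      image μ
    -- The hypothesis is applied with `G` itself as the convex subgraph, which requires `μ i` to be
    -- a vertex of `G`.
    , (λ v∈ → let i , μi≡v = ∈-image⁻ μ v∈ in
         subst (MedianConsistent G) μi≡v (consistent i G (convex-self (μ∈V i))))
    , injective⇒≤∣image∣ μ μ-injective)
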